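{- Let $\mathcal{C}$ be a class of finite directed graphs with bounded directed tree-partition width, i.e. there is $k\in\mathbb{N}$ with $\mathsf{dtpw}(G)\le k$ for all $G\in\mathcal{C}$. Then $\mathcal{C}$ has bounded directed tree width, bounded D-width, and bounded undirected tree width.
   Context: Directed tree-partition width. For a finite directed graph $G=(V,E)$ and a partition $\mathcal{P}=\{V_1,\ldots,V_n\}$ of $V$, the quotient of $G$ under $\mathcal{P}$ is the directed graph with vertex set $\mathcal{P}$ and an edge $(V_i,V_j)$ iff some $(s,t)\in E$ has $s\in V_i$, $t\in V_j$ (self-loops, i.e. $i=j$, are disregarded). A directed graph is a tree if its underlying undirected graph is a tree and every node has in-degree at most one. $\mathcal{P}$ is a directed tree partition of $G$ if the quotient is a tree, and $\mathsf{dtpw}(G)$ is the minimum over all directed tree partitions $\mathcal{P}$ of $G$ of $\max_{B\in\mathcal{P}}|B|$. Directed tree width (Johnson, Robertson, Seymour, Thomas). For $Z\subseteq V$, a set $A\subseteq V\setminus Z$ is $Z$-normal if there is no directed walk in $G\setminus Z$ whose first and last vertices are in $A$ and which uses a vertex of $V\setminus(Z\cup A)$. An arboreal decomposition of $G$ is a triple $(R,(X_e)_{e\in E(R)},(W_r)_{r\in V(R)})$ where $R$ is a rooted tree with all edges directed away from the root, the $X_e, W_r$ are subsets of $V$, the $W_r$ form a partition of $V$ into nonempty sets, and for every edge $e$ of $R$ the set $\bigcup\{W_r: r \text{ is the head of } e \text{ or a descendant of it}\}$ is $X_e$-normal. Its width is the least $w$ such that $|W_r\cup\bigcup_{e\sim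 r}X_e|\le w+1$ for all $r\in V(R)$, where $e\sim r$ means that $r$ is an endpoint of $e$. The directed tree width of $G$ is the least width of an arboreal decomposition of $G$. D-width (Safari). A D-decomposition of $G$ is a pair $(T,(W_t)_{t\in V(T)})$ with $T$ an undirected tree and $W_t\subseteq V$ such that for every nonempty $A\subseteq V$ for which the induced subgraph $G[A]$ is strongly connected, the graph with nodes $\{t\in V(T): W_t\cap A\neq\varnothing\}$ and edges $\{\{t,t'\}\in E(T): W_t\cap W_{t'}\cap A\ne\varnothing\}$ is a nonempty connected subtree of $T$. Its width is $\max_t|W_t|-1$, and the D-width of $G$ is the least width of a D-decomposition. Undirected tree width of $G$ is the usual tree width of the underlying undirected graph of $G$. -}

module Defs where

open import Level using (Level; 0ℓ)
open import Data.Nat using (ℕ; suc; _∸_; _⊔_; _≤_)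
open import Data.Fin using (Fin)
open import Data.Fin.Properties using (any?) renaming (_≟_ to _≟ᶠ_)
open import Data.Fin.Subset using (Subset; _∈_; _∉_; _∪_; _∩_; ∣_∣; Nonempty)
open import Data.Fin.Subset.Properties using (_∈?_)
open import Data.List using (List; []; _∷_; length)
open import Data.List.Membership.Propositional using () renaming (_∈_ to _∈ˡ_; _∉_ to _∉ˡ_)
open import Data.List.Relation.Unary.Unique.Propositional using (Unique)
open import Data.Product using (∃; ∃-syntax; ∃!; _×_; _,_)
open import Data.Sum using (_⊎_; swap)
open import Data.Vec using (tabulate)
open import Data.Vec.Functional using (foldr)
open import Relation.Binary using (Rel; Decidable; Symmetric; Irreflexive)
open import Relation.Binary.Construct.Closure.ReflexiveTransitive using (Star; ε; _◅_)
open import Relation.Binary.PropositionalEquality using (_≡_; _≢_; sym)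
open import Relation.Nullary using (¬_; does; ¬?; _×-dec_; _⊎-dec_)
open import Relation.Unary using (Pred; U) renaming (Decidable to Decidable₁)

private
  variable
    ℓ : Level
    n m : ℕ

maximum : (Fin m → ℕ) → ℕ
maximum = foldr _⊔_ 0

subset : {P : Pred (Fin n) 0ℓ} → Decidable₁ P → Subset n
subset P? = tabulate (λ v → does (P? v))

IsLeast : Pred ℕ 0ℓ → Pred ℕ 0ℓ
IsLeast S w = S w × (∀ w′ → S w′ → w ≤ w′)

------------------------------------------------------------------------
-- Graphs

-- Self-loops are allowed.
record Digraph : Set₁ where
  infix 4 _⟶_ _⟶?_
  field
    order : ℕ
    _⟶_   : Rel (Fin order) 0ℓ
    _⟶?_  : Decidable _⟶_

  inDegree : Fin order → ℕ
  inDegree t = ∣ subset (λ s → s ⟶? t) ∣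

record Graph : Set₁ where
  infix 4 _~_ _~?_
  field
    order    : ℕ
    _~_      : Rel (Fin order) 0ℓ
    _~?_     : Decidable _~_
    ~-sym    : Symmetric _~_
    ~-irrefl : Irreflexive _≡_ _~_

-- The simple graph obtained by forgetting directions: loops disappear and
-- antiparallel edges are identified.
underlying : Digraph → Graph
underlying G = record
  { order    = order
  ; _~_      = λ s t → s ≢ t × (s ⟶ t ⊎ t ⟶ s)
  ; _~?_     = λ s t → ¬? (s ≟ᶠ t) ×-dec (s ⟶? t ⊎-dec t ⟶? s)
  ; ~-sym    = λ (s≢t , e) → (λ t≡s → s≢t (sym t≡s)) , swap e
  ; ~-irrefl = λ s≡t (s≢t , _) → s≢t s≡t
  }
  where open Digraph G

-- Walks along a relation R are elements of Star R.
vertices : {A : Set} {R : Rel A 0ℓ} {u v : A} → Star R u v → List A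
vertices {u = u} ε       = u ∷ []
vertices {u = u} (_ ◅ p) = u ∷ vertices p

_↾_ : {A : Set} → Rel A 0ℓ → Pred A 0ℓ → Rel A 0ℓ
(R ↾ P) u v = P u × P v × R u v

-- The graph with vertex set N and (symmetric) edge relation R is a tree.
-- R is expected to relate members of N only.
record IsTreeOn {A : Set} (N : Pred A 0ℓ) (R : Rel A 0ℓ) : Set where
  field
    nonempty  : ∃ N
    connected : ∀ u v → N u → N v → Star R u v
    -- a cycle is a simple path on at least three vertices whose ends are adjacent
    acyclic   : ∀ {u v} (p : Star R u v) →
                Unique (vertices p) → 3 ≤ length (vertices p) → ¬ R v u

IsTree : Graph → Set
IsTree H = IsTreeOn U (Graph._~_ H)

IsDirectedTree : Digraph → Set
IsDirectedTree G = IsTree (underlying G) × (∀ t → Digraph.inDegree G t ≤ 1)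

-- R is a tree with root r whose edges all point away from r: the tail s of
-- an edge (s , t) can be reached from r in the underlying tree without
-- passing through the head t.
IsRootedTree : (R : Digraph) → Fin (Digraph.order R) → Set
IsRootedTree R r =
  IsTree (underlying R) ×
  (∀ {s t} → s ⟶ t → ∃[ p ] (t ∉ˡ vertices {R = _~_} {r} {s} p))
  where
    open Digraph R
    open Graph (underlying R) using (_~_)

IsPartition : (Fin m → Subset n) → Set
IsPartition P = (∀ i → Nonempty (P i)) × (∀ v → ∃! _≡_ (λ i → v ∈ P i))

------------------------------------------------------------------------
-- Directed tree-partition width

module _ (G : Digraph) where
  open Digraph G

  quotient : (Fin m → Subset order) → Digraph
  quotient {m} P = record
    { order = m
    ; _⟶_   = λ i j → i ≢ j × ∃[ s ] ∃[ t ] (s ∈ P i × t ∈ P j × s ⟶ t)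
    ; _⟶?_  = λ i j → ¬? (i ≟ᶠ j) ×-dec any? (λ s → any? (λ t →
                s ∈? P i ×-dec t ∈? P j ×-dec s ⟶? t))
    }

  record DirectedTreePartition : Set where
    field
      {size}      : ℕ
      part        : Fin size → Subset order
      isPartition : IsPartition part
      isTree      : IsDirectedTree (quotient part)

    width : ℕ
    width = maximum (λ i → ∣ part i ∣)

------------------------------------------------------------------------
-- Directed tree width

  Normal : Subset order → Pred (Fin order) 0ℓ → Set
  Normal Z A =
    (∀ v → A v → v ∉ Z) ×
    (∀ {a b} (p : Star (_⟶_ ↾ (_∉ Z)) a b) → A a → A b →
       ¬ (∃[ c ] (c ∈ˡ vertices p × c ∉ Z × ¬ A c)))

  record ArborealDecomposition : Set₁ where
    field
      R : Digraph
    open Digraph R public renaming (order to size; _⟶_ to _⟶ᴿ_; _⟶?_ to _⟶ᴿ?_; inDegree to inDegreeᴿ)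
    field
      root     : Fin size
      isRooted : IsRootedTree R root
      -- X s t is meaningful only when s ⟶ᴿ t
      X        : Fin size → Fin size → Subset order
      W        : Fin size → Subset order
      isPartition : IsPartition W

    below : Fin size → Pred (Fin order) 0ℓ
    below t v = ∃[ r ] (Star _⟶ᴿ_ t r × v ∈ W r)

    field
      normal : ∀ {s t} → s ⟶ᴿ t → Normal (X s t) (below t)

    -- the union of the X s t over the edges (s , t) having r as an endpoint
    guards : Fin size → Subset order
    guards r = subset (λ v → any? (λ s → any? (λ t →
      s ⟶ᴿ? t ×-dec (r ≟ᶠ s ⊎-dec r ≟ᶠ t) ×-dec v ∈? X s t)))

    IsWidth : Pred ℕ 0ℓ
    IsWidth = IsLeast (λ w → ∀ r → ∣ W r ∪ guards r ∣ ≤ suc w)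

------------------------------------------------------------------------
-- D-width

  InducesStronglyConnected : Subset order → Set
  InducesStronglyConnected A =
    ∀ u v → u ∈ A → v ∈ A → Star (_⟶_ ↾ (_∈ A)) u v

  record DDecomposition : Set₁ where
    field
      T : Graph
    open Graph T public renaming (order to size; _~_ to _~ᵀ_; _~?_ to _~ᵀ?_)
    field
      isTree  : IsTree T
      W       : Fin size → Subset order
      subtree : ∀ A → Nonempty A → InducesStronglyConnected A →
                IsTreeOn (λ t → Nonempty (W t ∩ A))
                         (λ t t′ → t ~ᵀ t′ × Nonempty ((W t ∩ W t′) ∩ A))

    -- Truncation only matters when G has no vertices.
    width : ℕ
    width = maximum (λ t → ∣ W t ∣) ∸ 1

------------------------------------------------------------------------
-- Undirected tree width

record TreeDecomposition (H : Graph) : Set₁ where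
  open Graph H
  field
    T : Graph
  open Graph T public using () renaming (order to size; _~_ to _~ᵀ_)
  field
    isTree  : IsTree T
    bag     : Fin size → Subset order
    edges   : ∀ {u v} → u ~ v → ∃[ t ] (u ∈ bag t × v ∈ bag t)
    subtree : ∀ v → IsTreeOn (λ t → v ∈ bag t)
                             (λ t t′ → t ~ᵀ t′ × v ∈ bag t × v ∈ bag t′)

  -- Truncation only matters when H has no vertices.
  width : ℕ
  width = maximum (λ t → ∣ bag t ∣) ∸ 1

------------------------------------------------------------------------
-- Width parameters

-- A width parameter assigns to G the set of widths of its decompositions;
-- its value at G is the minimum of this set.  Computing that minimum would
-- require deciding which decompositions exist, so "the minimum is at most k"
-- is expressed as "some element is at most k".  In particular, a graph without
-- any decomposition satisfies no bound.
WidthParameter : Set₂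
WidthParameter = Digraph → Pred ℕ (Level.suc 0ℓ)

infix 4 _⟨_⟩≤_
_⟨_⟩≤_ : WidthParameter → Digraph → ℕ → Set₁
μ ⟨ G ⟩≤ k = ∃[ w ] (μ G w × w ≤ k)

dtpw : WidthParameter
dtpw G w = ∃[ D ] Level.Lift (Level.suc 0ℓ) (DirectedTreePartition.width {G} D ≡ w)

dtw : WidthParameter
dtw G w = ∃[ D ] ArborealDecomposition.IsWidth {G} D w

D-width : WidthParameter
D-width G w = ∃[ D ] (DDecomposition.width {G} D ≡ w)

tw : WidthParameter
tw G w = ∃[ D ] (TreeDecomposition.width {underlying G} D ≡ w)

Bounded : WidthParameter → Pred Digraph ℓ → Set _
Bounded μ 𝒞 = ∃[ k ] (∀ G → 𝒞 G → μ ⟨ G ⟩≤ k)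

{-# OPTIONS --safe #-}

-- Only the tree structure of the quotient H matters.  Root H at any vertex by
-- breadth-first search, and put bag i = V_i ∪ V_(parent of i), of size at most
-- 2k.  The bags over H form a tree decomposition, since the bags containing a
-- vertex of V_i are among those of i and its children.  A tree decomposition is
-- also a D-decomposition, as consecutive vertices of a walk share a bag.
-- Finally H with W_i = V_i and X_(s,t) = V_s is an arboreal decomposition: a
-- walk leaving the part of G below t has to pass through V_s, and
-- W_r ∪ ⋃_(e ∼ r) X_e ⊆ bag r.
module Submission where

open import Level using (Level; 0ℓ; lift)
open import Data.Fin using (Fin; zero; suc)
open import Data.Fin.Properties using (any?; all?) renaming (_≟_ to _≟ᶠ_)
open import Data.Fin.Subset using (Subset; inside; outside; _∈_; _∉_; _⊆_; _∪_; _∩_; ∣_∣; Nonempty)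
open import Data.Fin.Subset.Properties using (_∈?_; x∈p∪q⁺; x∈p∪q⁻; x∈p∩q⁺; x∈p∩q⁻; p⊆q⇒∣p∣≤∣q∣)
open import Data.List using (_∷_; length)
open import Data.List.Membership.Propositional using () renaming (_∈_ to _∈ˡ_)
open import Data.List.Relation.Unary.All as All using (All; []; _∷_)
open import Data.List.Relation.Unary.All.Properties using (¬Any⇒All¬)
open import Data.List.Relation.Unary.AllPairs using ([]; _∷_)
open import Data.List.Relation.Unary.Any using (here; there) renaming (any? to anyˡ?)
open import Data.List.Relation.Unary.Unique.Propositional using (Unique)
open import Data.Nat using (ℕ; zero; suc; _+_; _≤_; _<_; _≤?_; z≤n; s≤s)
open import Data.Nat.Induction using (<-wellFounded)
open import Data.Nat.Properties using (≤-refl; ≤-trans; ≤-reflexive; <-trans; <-≤-trans; <-irrefl; n≤1+n; m∸n≤m; +-mono-≤; +-suc; m≤m⊔n; m≤n⊔m; ⊔-lub)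
open import Data.Product using (∃; ∃-syntax; _×_; _,_; proj₁; proj₂)
open import Data.Sum using (_⊎_; inj₁; inj₂; [_,_]′)
open import Data.Vec using ([]; _∷_)
open import Data.Vec.Properties using ([]=⇒lookup; lookup∘tabulate)
open import Function using (_∘_; id; flip)
open import Induction.WellFounded using (Acc; acc)
open import Relation.Binary using (Rel; DecidableEquality; _⇒_)
open import Relation.Binary.Construct.Closure.ReflexiveTransitive as Star using (Star; ε; _◅_; _◅◅_)
open import Relation.Binary.PropositionalEquality using (_≡_; _≢_; refl; sym; trans; cong; subst)
open import Relation.Nullary using (¬_; Dec; yes; no; does; ¬?; _×-dec_; _⊎-dec_; contradiction)
open import Relation.Unary using (Pred; U) renaming (Decidable to Decidable₁)
open import Defs

private
  variable
    n : ℕ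
    A : Set

-- Maxima, cardinalities and least elements

≤-maximum : (f : Fin n → ℕ) (i : Fin n) → f i ≤ maximum f
≤-maximum f zero    = m≤m⊔n _ _
≤-maximum f (suc i) = ≤-trans (≤-maximum (f ∘ suc) i) (m≤n⊔m _ _)

maximum-≤ : ∀ {n k} {f : Fin n → ℕ} → (∀ i → f i ≤ k) → maximum f ≤ k
maximum-≤ {zero}  f≤k = z≤n
maximum-≤ {suc n} f≤k = ⊔-lub (f≤k zero) (maximum-≤ (f≤k ∘ suc))

∣p∪q∣≤∣p∣+∣q∣ : (p q : Subset n) → ∣ p ∪ q ∣ ≤ ∣ p ∣ + ∣ q ∣
∣p∪q∣≤∣p∣+∣q∣ []            []            = z≤n
∣p∪q∣≤∣p∣+∣q∣ (outside ∷ p) (outside ∷ q) = ∣p∪q∣≤∣p∣+∣q∣ p q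
∣p∪q∣≤∣p∣+∣q∣ (outside ∷ p) (inside ∷ q)  =
  ≤-trans (s≤s (∣p∪q∣≤∣p∣+∣q∣ p q)) (≤-reflexive (sym (+-suc ∣ p ∣ ∣ q ∣)))
∣p∪q∣≤∣p∣+∣q∣ (inside ∷ p)  (outside ∷ q) = s≤s (∣p∪q∣≤∣p∣+∣q∣ p q)
∣p∪q∣≤∣p∣+∣q∣ (inside ∷ p)  (inside ∷ q)  =
  s≤s (≤-trans (∣p∪q∣≤∣p∣+∣q∣ p q) (+-mono-≤ (≤-refl {∣ p ∣}) (n≤1+n ∣ q ∣)))

∈-subset⁻ : {P : Pred (Fin n) 0ℓ} (P? : Decidable₁ P) {v : Fin n} → v ∈ subset P? → P v
∈-subset⁻ P? {v} v∈ with P? v | trans (sym (lookup∘tabulate (does ∘ P?) v)) ([]=⇒lookup v∈)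
... | yes Pv | _  = Pv
... | no _   | ()

-- Both `depth` and the exact value required by `IsWidth` are minima of decidable sets; a known
-- element `n` bounds the search.
least : {S : Pred ℕ 0ℓ} → Decidable₁ S → ∀ n → S n → ∃ (IsLeast S)
least S? zero Sn = zero , Sn , λ _ _ → z≤n
least S? (suc n) Sn with S? zero
... | yes S0 = zero , S0 , λ _ _ → z≤n
... | no ¬S0 with least (S? ∘ suc) n Sn
...   | w , Sw , w≤ = suc w , Sw , λ where
          zero    S0 → contradiction S0 ¬S0
          (suc m) Sm → s≤s (w≤ m Sm)

-- Walks and acyclicity

vertices-map : {R S : Rel A 0ℓ} (f : R ⇒ S) {u v : A} (p : Star R u v) →
               vertices (Star.map f p) ≡ vertices p
vertices-map f ε                   = refl
vertices-map f (_◅_ {i = u} e p) = cong (u ∷_) (vertices-map f p)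

forget-↾ : {R : Rel A 0ℓ} {P : Pred A 0ℓ} {u v : A} → P v → Star (R ↾ P) u v →
           ∃[ p ] All P (vertices {R = R} {u} {v} p)
forget-↾ Pv ε = ε , Pv ∷ []
forget-↾ Pv ((Pu , _ , e) ◅ p) with forget-↾ Pv p
... | p′ , all = e ◅ p′ , Pu ∷ all

module _ {R : Rel A 0ℓ} where

  simple-suffix : ∀ {u v w} (p : Star R u v) → Unique (vertices p) → w ∈ˡ vertices p →
                  ∃[ q ] Unique (vertices {R = R} {w} {v} q)
  simple-suffix ε       unique       (here refl) = ε , unique
  simple-suffix (e ◅ p) unique       (here refl) = e ◅ p , unique
  simple-suffix (e ◅ p) (_ ∷ unique) (there w∈p) = simple-suffix p unique w∈p

  -- Loop erasure: if `u` recurs on the simplified tail, only the suffix from `u` is kept.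
  simplify : DecidableEquality A → ∀ {u v} → Star R u v →
             ∃[ p ] Unique (vertices {R = R} {u} {v} p)
  simplify _≟_ ε = ε , [] ∷ []
  simplify _≟_ {u} (e ◅ p) with simplify _≟_ p
  ... | q , unique with anyˡ? (u ≟_) (vertices q)
  ...   | yes u∈q = simple-suffix q unique u∈q
  ...   | no  u∉q = e ◅ q , ¬Any⇒All¬ _ u∉q ∷ unique

Acyclic : Rel A 0ℓ → Set
Acyclic R = ∀ {u v} (p : Star R u v) → Unique (vertices p) → 3 ≤ length (vertices p) → ¬ R v u

-- A cycle survives enlarging the relation. The subtrees in both decompositions thus inherit
-- acyclicity from the ambient tree, and connectedness is the main thing left to check.
acyclic-antitone : {R S : Rel A 0ℓ} → R ⇒ S → Acyclic S → Acyclic R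
acyclic-antitone f acyclic p unique long e =
  acyclic (Star.map f p)
    (subst Unique (sym (vertices-map f p)) unique)
    (subst (λ xs → 3 ≤ length xs) (sym (vertices-map f p)) long)
    (f e)

-- A simple walk from `u` to `v` is empty, a single edge, or has at least three vertices and is
-- closed into a cycle by `R v u`. Only the ordered step is forbidden, so in `~⇒parent` the ascent
-- and the descent each need one inequality.
acyclic⇒bridge : DecidableEquality A → {R : Rel A 0ℓ} → Acyclic R →
                 ∀ {u v} → u ≢ v → R v u → ¬ Star (λ x y → R x y × ¬ (x ≡ u × y ≡ v)) u v
acyclic⇒bridge _≟_ acyclic u≢v vu p with simplify _≟_ p
... | ε                        , _      = u≢v refl
... | (_ , not-uv) ◅ ε         , _      = not-uv (refl , refl)
... | q@(_ ◅ _ ◅ q′) , unique =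
  acyclic (Star.map proj₁ q)
    (subst Unique (sym (vertices-map proj₁ q)) unique)
    (s≤s (s≤s (subst (1 ≤_) (cong length (sym (vertices-map proj₁ q′))) (1≤length q′))))
    vu
  where
  1≤length : ∀ {R : Rel A 0ℓ} {u v} (p : Star R u v) → 1 ≤ length (vertices p)
  1≤length ε       = s≤s z≤n
  1≤length (_ ◅ _) = s≤s z≤n

isTreeOn-resp : {N : Pred A 0ℓ} {R S : Rel A 0ℓ} → R ⇒ S → S ⇒ R → IsTreeOn N R → IsTreeOn N S
isTreeOn-resp R⇒S S⇒R tree = record
  { nonempty  = nonempty
  ; connected = λ u v Nu Nv → Star.map R⇒S (connected u v Nu Nv)
  ; acyclic   = acyclic-antitone S⇒R acyclic
  }
  where open IsTreeOn tree

-- Rooting a tree by distance from a vertex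

module Rooting (H : Graph) (tree : IsTree H) where
  open Graph H
  open IsTreeOn tree

  root : Fin order
  root = proj₁ nonempty

  -- Walks to the root with exactly `n` edges, encoded by recursion on `n` to be decidable; the
  -- least such `n` is the distance to the root.
  Reach : Fin order → Pred ℕ 0ℓ
  Reach t zero    = t ≡ root
  Reach t (suc n) = ∃[ u ] (t ~ u × Reach u n)

  reach? : ∀ t → Decidable₁ (Reach t)
  reach? t zero    = t ≟ᶠ root
  reach? t (suc n) = any? (λ u → t ~? u ×-dec reach? u n)

  reach : ∀ {t} → Star _~_ t root → ∃ (Reach t)
  reach ε       = zero , refl
  reach (e ◅ p) with reach p
  ... | n , r = suc n , _ , e , r

  nearest : ∀ t → ∃ (IsLeast (Reach t))
  nearest t with reach (connected t root _ _)
  ... | n , r = least (reach? t) n r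

  depth : Fin order → ℕ
  depth t = proj₁ (nearest t)

  -- The rest of a walk with `suc n` edges bounds the depth of its second vertex by `n`. The length
  -- is kept general to allow the case split; `parent-step` sets it to `depth t`.
  first-step : ∀ {t} n → Reach t n →
               ∃[ u ] ((t ≡ root × u ≡ root) ⊎ (t ~ u × depth u < n))
  -- The root becomes its own parent, which keeps `parent` total.
  first-step zero    t≡root      = root , inj₁ (t≡root , refl)
  first-step (suc n) (u , e , r) = u , inj₂ (e , s≤s (proj₂ (proj₂ (nearest u)) n r))

  parent-step : ∀ t → ∃[ u ] ((t ≡ root × u ≡ root) ⊎ (t ~ u × depth u < depth t))
  parent-step t = first-step (depth t) (proj₁ (proj₂ (nearest t)))

  parent : Fin order → Fin order
  parent t = proj₁ (parent-step t)

  parent-spec : ∀ t → (t ≡ root × parent t ≡ root) ⊎ (t ~ parent t × depth (parent t) < depth t)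
  parent-spec t = proj₂ (parent-step t)

  -- Ascent to the root by well-founded recursion on depth, with an invariant `P`. A flipped `S`
  -- yields, after reversal, a walk down from the root.
  climb : {P : Pred (Fin order) 0ℓ} {S : Rel (Fin order) 0ℓ} →
          (∀ {x} → P x → x ~ parent x → depth (parent x) < depth x →
             P (parent x) × S x (parent x)) →
          ∀ {t} → P t → Star S t root
  climb {P} {S} step {t} = go t (<-wellFounded (depth t))
    where
    go : ∀ t → Acc _<_ (depth t) → P t → Star S t root
    go t (acc rec) Pt with parent-spec t
    ... | inj₁ (t≡root , _) = subst (Star S t) t≡root ε
    ... | inj₂ (e , d<) with step Pt e d<
    ...   | Pp , s = s ◅ go (parent t) (rec d<) Pp

  ~⇒parent : ∀ {s t} → s ~ t → parent s ≡ t ⊎ parent t ≡ s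
  ~⇒parent {s} {t} s~t with parent s ≟ᶠ t | parent t ≟ᶠ s
  ... | yes p | _     = inj₁ p
  ... | no _  | yes q = inj₂ q
  -- Climbing from s to the root and descending to t would bypass the edge s ~ t.
  ... | no ps≢t | no pt≢s = contradiction (up ◅◅ Star.reverse id down)
      (acyclic⇒bridge _≟ᶠ_ acyclic (λ s≡t → ~-irrefl s≡t s~t) (~-sym s~t))
    where
    E : Rel (Fin order) 0ℓ
    E x y = x ~ y × ¬ (x ≡ s × y ≡ t)

    up : Star E s root
    up = climb {P = U} (λ _ e _ → _ , e , λ { (refl , q) → ps≢t q }) _

    down : Star (flip E) t root
    down = climb {P = U} (λ _ e _ → _ , ~-sym e , λ { (q , refl) → pt≢s q }) _

  infix 4 _⟶_
  -- The condition `s ≢ t` excludes a loop at the root, which is its own parent.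
  _⟶_ : Rel (Fin order) 0ℓ
  s ⟶ t = s ≢ t × parent t ≡ s

  rooted : Digraph
  rooted = record
    { order = order
    ; _⟶_   = _⟶_
    ; _⟶?_  = λ s t → ¬? (s ≟ᶠ t) ×-dec (parent t ≟ᶠ s)
    }

  open Digraph rooted public using (_⟶?_)
  open Graph (underlying rooted) using () renaming (_~_ to _~ᴿ_)

  ⟶-spec : ∀ {s t} → s ⟶ t → s ~ t × depth s < depth t
  ⟶-spec {s} {t} (s≢t , refl) with parent-spec t
  ... | inj₁ (t≡root , s≡root) = contradiction (trans s≡root (sym t≡root)) s≢t
  ... | inj₂ (e , d<)          = ~-sym e , d<

  ~⇒~ᴿ : _~_ ⇒ _~ᴿ_
  ~⇒~ᴿ {s} {t} e = s≢t , orient (~⇒parent e)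
    where
    s≢t : s ≢ t
    s≢t s≡t = ~-irrefl s≡t e
    orient : parent s ≡ t ⊎ parent t ≡ s → s ⟶ t ⊎ t ⟶ s
    orient (inj₁ p) = inj₂ (s≢t ∘ sym , p)
    orient (inj₂ p) = inj₁ (s≢t , p)

  ~ᴿ⇒~ : _~ᴿ_ ⇒ _~_
  ~ᴿ⇒~ (_ , inj₁ e) = proj₁ (⟶-spec e)
  ~ᴿ⇒~ (_ , inj₂ e) = ~-sym (proj₁ (⟶-spec e))

  rooted-isRootedTree : IsRootedTree rooted root
  rooted-isRootedTree = isTreeOn-resp ~⇒~ᴿ ~ᴿ⇒~ tree , away
    where
    -- Depth decreases on the way from s up to the root, so that way avoids t.
    away : ∀ {s t} → s ⟶ t → ∃[ p ] (¬ (t ∈ˡ vertices {R = _~ᴿ_} {root} {s} p))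
    away {s} {t} e = proj₁ path , λ t∈p → <-irrefl refl (All.lookup (proj₂ path) t∈p)
      where
      Shallow : Pred (Fin order) 0ℓ
      Shallow x = depth x < depth t

      ascent : Star (flip (_~ᴿ_ ↾ Shallow)) s root
      ascent = climb {P = Shallow}
        (λ x< x~p p<x → <-trans p<x x< , <-trans p<x x< , x< , ~⇒~ᴿ (~-sym x~p))
        (proj₂ (⟶-spec e))

      path : ∃[ p ] All Shallow (vertices {R = _~ᴿ_} {root} {s} p)
      path = forget-↾ (proj₂ (⟶-spec e)) (Star.reverse id ascent)

  descendant-depth : ∀ {t r} → Star _⟶_ t r → depth t ≤ depth r
  descendant-depth ε       = ≤-refl
  descendant-depth (e ◅ p) =
    ≤-trans (≤-trans (n≤1+n _) (proj₂ (⟶-spec e))) (descendant-depth p)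

  -- The last edge into `r` starts at `parent r`, so a proper ancestor of `r` is an ancestor of its
  -- parent. This handles the upward steps in `closed`.
  descendant-parent : ∀ {t r} → Star _⟶_ t r → t ≡ r ⊎ Star _⟶_ t (parent r)
  descendant-parent ε       = inj₁ refl
  descendant-parent (e ◅ p) with descendant-parent p
  ... | inj₁ refl = inj₂ (subst (Star _⟶_ _) (sym (proj₂ e)) ε)
  ... | inj₂ q    = inj₂ (e ◅ q)

-- From tree decompositions to D-decompositions

module _ {G : Digraph} (D : TreeDecomposition (underlying G)) where
  open Digraph G
  open TreeDecomposition D

  toDDecomposition : DDecomposition G
  toDDecomposition = record
    { T       = T
    ; isTree  = isTree
    ; W       = bag
    ; subtree = λ A (a , a∈A) strong → record
      { nonempty  = (λ (t , a∈t) → t , a , x∈p∩q⁺ (a∈t , a∈A)) (IsTreeOn.nonempty (subtree a))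
      ; connected = λ t t′ (x , x∈) (y , y∈) →
          let x∈t  , x∈A = x∈p∩q⁻ _ _ x∈
              y∈t′ , y∈A = x∈p∩q⁻ _ _ y∈
          in spread A (strong x y x∈A y∈A) x∈A x∈t y∈t′
      ; acyclic   = acyclic-antitone proj₁ (IsTreeOn.acyclic isTree)
      }
    }
    where
    -- Each vertex of the walk is carried through the connected family of bags containing it, up to
    -- a bag shared with the next vertex. As it lies in `A`, it witnesses the triple intersection on
    -- every tree edge crossed.
    spread : ∀ A {x y t t′} → Star (_⟶_ ↾ (_∈ A)) x y → x ∈ A → x ∈ bag t → y ∈ bag t′ →
             Star (λ t t′ → t ~ᵀ t′ × Nonempty ((bag t ∩ bag t′) ∩ A)) t t′
    spread A {x} ε x∈A x∈t x∈t′ =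
      Star.map (λ (e , x∈s , x∈s′) → e , x , x∈p∩q⁺ (x∈p∩q⁺ (x∈s , x∈s′) , x∈A))
        (IsTreeOn.connected (subtree x) _ _ x∈t x∈t′)
    spread A {x} (_◅_ {j = z} (_ , z∈A , e) p) x∈A x∈t y∈t′ with x ≟ᶠ z
    -- A loop of `G` is not an edge of `underlying G`, so `edges` gives no bag for it; it is
    -- skipped.
    ... | yes refl = spread A p z∈A x∈t y∈t′
    ... | no  x≢z with edges (x≢z , inj₁ e)
    ...   | s , x∈s , z∈s = spread A ε x∈A x∈t x∈s ◅◅ spread A p z∈A z∈s y∈t′

-- Decompositions built from a directed tree partition

module _ {G : Digraph} (D : DirectedTreePartition G) where
  open Digraph G using (order) renaming (_⟶_ to _⟶ᴳ_)
  open DirectedTreePartition D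

  private
    H : Graph
    H = underlying (quotient G part)

    tree : IsTree H
    tree = proj₁ isTree

  open Graph H using (_~_)
  open Rooting H tree

  index : Fin order → Fin size
  index v = proj₁ (proj₂ isPartition v)

  ∈-index : ∀ v → v ∈ part (index v)
  ∈-index v = proj₁ (proj₂ (proj₂ isPartition v))

  index-unique : ∀ {v i} → v ∈ part i → index v ≡ i
  index-unique {v} = proj₂ (proj₂ (proj₂ isPartition v))

  edge⇒~ : ∀ {u v} → u ⟶ᴳ v → index u ≢ index v → index u ~ index v
  edge⇒~ {u} {v} e i≢j = i≢j , inj₁ (i≢j , u , v , ∈-index u , ∈-index v , e)

  bag : Fin size → Subset order
  bag t = part t ∪ part (parent t)

  ∣bag∣≤ : ∀ {k} → width ≤ k → ∀ t → ∣ bag t ∣ ≤ k + k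
  ∣bag∣≤ {k} w≤k t =
    ≤-trans (∣p∪q∣≤∣p∣+∣q∣ (part t) (part (parent t))) (+-mono-≤ (small t) (small (parent t)))
    where
    small : ∀ i → ∣ part i ∣ ≤ k
    small i = ≤-trans (≤-maximum (λ i → ∣ part i ∣) i) w≤k

  ∈-bag : ∀ v → v ∈ bag (index v)
  ∈-bag v = x∈p∪q⁺ (inj₁ (∈-index v))

  ∈-child-bag : ∀ {v t} → parent t ≡ index v → v ∈ bag t
  ∈-child-bag {v} eq = x∈p∪q⁺ (inj₂ (subst (λ i → v ∈ part i) (sym eq) (∈-index v)))

  toTreeDecomposition : TreeDecomposition (underlying G)
  toTreeDecomposition = record
    { T       = H
    ; isTree  = tree
    ; bag     = bag
    ; edges   = covered
    ; subtree = λ v → record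
      { nonempty  = index v , ∈-bag v
      ; connected = λ t t′ v∈t v∈t′ →
          to-index v∈t ◅◅ Star.reverse (λ (e , a , b) → Graph.~-sym H e , b , a) (to-index v∈t′)
      ; acyclic   = acyclic-antitone proj₁ (IsTreeOn.acyclic tree)
      }
    }
    where
    covered-~ : ∀ {u v} → index u ≡ index v ⊎ index u ~ index v → ∃[ t ] (u ∈ bag t × v ∈ bag t)
    covered-~ {u} {v} (inj₁ eq) = index v , subst (λ i → u ∈ bag i) eq (∈-bag u) , ∈-bag v
    -- The bag of whichever end is the child contains both parts.
    covered-~ {u} {v} (inj₂ e) with ~⇒parent e
    ... | inj₁ eq = index u , ∈-bag u , ∈-child-bag eq
    ... | inj₂ eq = index v , ∈-child-bag eq , ∈-bag v

    covered : ∀ {u v} → Graph._~_ (underlying G) u v → ∃[ t ] (u ∈ bag t × v ∈ bag t)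
    covered {u} {v} (_ , e) with index u ≟ᶠ index v | e
    ... | yes eq | _       = covered-~ (inj₁ eq)
    ... | no i≢j | inj₁ uv = covered-~ (inj₂ (edge⇒~ uv i≢j))
    ... | no i≢j | inj₂ vu = covered-~ (inj₂ (Graph.~-sym H (edge⇒~ vu (i≢j ∘ sym))))

    -- A bag containing `v` is that of `index v` or of one of its children, so at most one tree edge
    -- is crossed.
    to-index : ∀ {v t} → v ∈ bag t →
               Star (λ s s′ → s ~ s′ × v ∈ bag s × v ∈ bag s′) t (index v)
    to-index {v} {t} v∈t with x∈p∪q⁻ (part t) (part (parent t)) v∈t | parent-spec t
    ... | inj₁ v∈Pt | _                 = subst (Star _ t) (sym (index-unique v∈Pt)) ε
    -- At the root both halves of the bag are the same part, so `t` is already `index v`.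
    ... | inj₂ v∈Pp | inj₁ (t≡r , p≡r)  =
      subst (Star _ t) (trans t≡r (trans (sym p≡r) (sym (index-unique v∈Pp)))) ε
    ... | inj₂ v∈Pp | inj₂ (t~p , _)    =
      subst (Star _ t) (sym (index-unique v∈Pp)) ((t~p , v∈t , x∈p∪q⁺ (inj₁ v∈Pp)) ◅ ε)

  toArborealDecomposition : ArborealDecomposition G
  toArborealDecomposition = record
    { R           = rooted
    ; root        = root
    ; isRooted    = rooted-isRootedTree
    ; X           = λ s _ → part s
    ; W           = part
    ; isPartition = isPartition
    ; normal      = λ s⟶t → (λ _ → disjoint s⟶t) ,
        λ p a b (c , c∈p , _ , ¬c) → ¬c (All.lookup (trapped s⟶t p a) c∈p)
    }
    where
    Below : Fin size → Pred (Fin order) 0ℓ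
    Below t v = ∃[ r ] (Star _⟶_ t r × v ∈ part r)

    -- The part containing `v` would be both `s` and a descendant of `t`, although `s` has smaller
    -- depth than every such descendant.
    disjoint : ∀ {s t v} → s ⟶ t → Below t v → v ∉ part s
    disjoint s⟶t (r , t⟶*r , v∈r) v∈s with trans (sym (index-unique v∈r)) (index-unique v∈s)
    ... | refl = <-irrefl refl (<-≤-trans (proj₂ (⟶-spec s⟶t)) (descendant-depth t⟶*r))

    -- An edge of `G` leaving part `r` enters a child or the parent of `r`. Children stay below `t`;
    -- so does the parent unless `r` is `t`, whose parent is `s`, and `v` avoids `part s`.
    closed : ∀ {s t u v} → s ⟶ t → Below t u → v ∉ part s → u ⟶ᴳ v → Below t v
    closed {s} {t} {u} {v} s⟶t (r , t⟶*r , u∈r) v∉s e with index-unique u∈r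
    ... | refl with index u ≟ᶠ index v
    ...   | yes eq = index v , subst (Star _⟶_ t) eq t⟶*r , ∈-index v
    ...   | no i≢j with ~⇒parent (edge⇒~ e i≢j)
    ...     | inj₂ eq = index v , t⟶*r ◅◅ (i≢j , eq) ◅ ε , ∈-index v
    ...     | inj₁ eq with descendant-parent t⟶*r
    ...       | inj₁ refl =
      contradiction (subst (λ i → v ∈ part i) (trans (sym eq) (proj₂ s⟶t)) (∈-index v)) v∉s
    ...       | inj₂ t⟶*p = index v , subst (Star _⟶_ t) eq t⟶*p , ∈-index v

    trapped : ∀ {s t} → s ⟶ t → ∀ {a b} (p : Star (_⟶ᴳ_ ↾ (_∉ part s)) a b) →
              Below t a → All (Below t) (vertices p)
    trapped s⟶t ε                     a = a ∷ []
    trapped s⟶t ((_ , v∉s , e) ◅ p) a = a ∷ trapped s⟶t p (closed s⟶t a v∉s e)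

  open ArborealDecomposition toArborealDecomposition using (guards; IsWidth)

  -- An edge out of `r` contributes `part r`, and the edge into `r` contributes the part of its
  -- parent.
  guards⊆bag : ∀ r → part r ∪ guards r ⊆ bag r
  guards⊆bag r v∈ = [ (λ v∈r → x∈p∪q⁺ (inj₁ v∈r)) , guard⊆bag ]′ (x∈p∪q⁻ (part r) (guards r) v∈)
    where
    -- Spelled as in the definition of `guards`, so that `guards r` is `subset guarded?` by
    -- computation.
    guarded? : ∀ v → Dec (∃[ s ] ∃[ t ] (s ⟶ t × (r ≡ s ⊎ r ≡ t) × v ∈ part s))
    guarded? v = any? (λ s → any? (λ t →
      s ⟶? t ×-dec (r ≟ᶠ s ⊎-dec r ≟ᶠ t) ×-dec v ∈? part s))

    guard⊆bag : guards r ⊆ bag r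
    guard⊆bag v∈g with ∈-subset⁻ guarded? v∈g
    ... | s , t , _          , inj₁ refl , v∈s = x∈p∪q⁺ (inj₁ v∈s)
    ... | s , t , (_ , refl) , inj₂ refl , v∈s = x∈p∪q⁺ (inj₂ v∈s)

  -- `dtw` asks for the exact least width of the decomposition, for which `k + k` is only an upper
  -- bound; `least` finds it. Keeping `k + k` rather than one less avoids truncated subtraction.
  dtw-bound : ∀ {k} → width ≤ k → dtw ⟨ G ⟩≤ (k + k)
  dtw-bound {k} w≤k =
    proj₁ minimal , (toArborealDecomposition , proj₂ minimal) , proj₂ (proj₂ minimal) (k + k) small
    where
    small : ∀ r → ∣ part r ∪ guards r ∣ ≤ suc (k + k)
    small r = ≤-trans (p⊆q⇒∣p∣≤∣q∣ (guards⊆bag r)) (≤-trans (∣bag∣≤ w≤k r) (n≤1+n _))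

    minimal : ∃ IsWidth
    minimal = least (λ w → all? (λ r → ∣ part r ∪ guards r ∣ ≤? suc w)) (k + k) small

  tw-bound : ∀ {k} → width ≤ k → tw ⟨ G ⟩≤ (k + k)
  tw-bound w≤k =
    _ , (toTreeDecomposition , refl) , ≤-trans (m∸n≤m _ 1) (maximum-≤ (∣bag∣≤ w≤k))

-- Bounds for the whole class

D-width≤tw : ∀ {G k} → tw ⟨ G ⟩≤ k → D-width ⟨ G ⟩≤ k
D-width≤tw (w , (D , eq) , w≤k) = w , (toDDecomposition D , eq) , w≤k

proposition3 : {ℓ : Level} (𝒞 : Pred Digraph ℓ) → Bounded dtpw 𝒞 →
    Bounded dtw 𝒞 × Bounded D-width 𝒞 × Bounded tw 𝒞
proposition3 𝒞 (k , bound) =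
  (k + k , λ G G∈𝒞 → dtw≤ (bound G G∈𝒞)) ,
  (k + k , λ G G∈𝒞 → D-width≤tw (tw≤ (bound G G∈𝒞))) ,
  (k + k , λ G G∈𝒞 → tw≤ (bound G G∈𝒞))
  where
  dtw≤ : ∀ {G} → dtpw ⟨ G ⟩≤ k → dtw ⟨ G ⟩≤ (k + k)
  dtw≤ (_ , (D , lift refl) , w≤k) = dtw-bound D w≤k

  tw≤ : ∀ {G} → dtpw ⟨ G ⟩≤ k → tw ⟨ G ⟩≤ (k + k)
  tw≤ (_ , (D , lift refl) , w≤k) = tw-bound D w≤k
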